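{- Let $\mathbb K$ be a field of characteristic $p>2$, $\Lambda_1,\dots,\Lambda_n\in\mathbb F_p^\times\subset\mathbb K$, $a\in\mathbb K\setminus\mathbb F_p$, and let $x^0\in\mathbb K^n$ be such that all $2np$ linear polynomials $s-x_i^0+\Lambda_i+aj$, $s-x_i^0+aj$ ($i=1,\dots,n$, $j=0,\dots,p-1$) in $s$ are pairwise distinct. Put $y_i^0=x_i^0-\Lambda_i$ and let $s_i(\varepsilon)\in\mathbb K[[\varepsilon]]$ be the formal branches defined in the context. Then for each $i=1,\dots,n$ the pullback $J(s_i(\varepsilon),x^0)$ is regular at $\varepsilon=0$ (its coordinates lie in $\mathbb K[[\varepsilon]]$), and $$J(s_i(\varepsilon),x^0)=W(y_i^0,x^0)+\mathcal O(\varepsilon).$$ The vectors $W(y_i^0,x^0)$, $i=1,\dots,n$, form a basis of $V_{\mathbb K}$.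
   Context: $\mathbb F_p$ is the prime subfield of $\mathbb K$, $n\ge1$. $V_{\mathbb K}$ is an $n$-dimensional $\mathbb K$-vector space with basis $f^{(1)},\dots,f^{(n)}$ (in the paper, a weight subspace of a tensor product of Verma modules). $W(s,x)=\sum_{j=1}^nW_j(s,x)f^{(j)}$ with $W_j(s,x)=\prod_{l<j}(s-x_l+\Lambda_l)\prod_{l>j}(s-x_l)$. With $\kappa=\varepsilon^{ -1}$, $$\Phi(s,x)=\kappa\prod_{l=1}^n\frac{s-x_l+\Lambda_l}{s-x_l+a},\qquad J(s,x)=\sum_{d=0}^{p-1}W(s+da,x)\prod_{j=0}^{d-1}\Phi(s+aj,x).$$ $s_i(\varepsilon)\in\mathbb K[[\varepsilon]]$ is the unique formal power series with $s_i(0)=y_i^0$ satisfying $$\prod_{l=1}^n\prod_{j=0}^{p-1}(s-x_l^0+\Lambda_l+aj)=\varepsilon^p\prod_{l=1}^n\prod_{j=0}^{p-1}(s-x_l^0+aj)$$ at $s=s_i(\varepsilon)$. $\mathcal O(\varepsilon)$ denotes a vector with coordinates in $\varepsilon\mathbb K[[\varepsilon]]$. -}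

module Defs where

open import Level using (Level; _⊔_)
open import Algebra.Apartness.Bundles using (HeytingField; HeytingCommutativeRing)
open import Algebra.Bundles using (CommutativeRing)
open import Algebra.Bundles.Raw using (RawRing)
open import Algebra.Module.Bundles using (Module)
import Algebra.Definitions.RawMonoid as RawMonoidDefs
import Algebra.Definitions.RawSemiring as RawSemiringDefs
open import Data.Bool.Base using (if_then_else_)
open import Data.Fin.Base using (Fin; toℕ)
open import Data.Fin.Properties using (_<?_)
open import Data.Nat.Base using (ℕ; zero; suc; _∸_)
open import Data.Nat.Divisibility using (_∣_)
open import Data.Product.Base using (_×_; _,_; ∃; ∃-syntax)
open import Data.Sum.Base using (_⊎_; inj₁; inj₂)
open import Function.Bundles using (_⇔_)
open import Relation.Binary.PropositionalEquality.Core using (_≢_)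
open import Relation.Nullary.Decidable.Core using (does)

private
  variable
    c ℓ ℓ₁ ℓ₂ m ℓm : Level
    n : ℕ

module PowerSeries (R : RawRing c ℓ) where
  open RawRing R
  open RawSemiringDefs rawSemiring using (sum)

  -- f k is the coefficient of εᵏ.
  Series : Set c
  Series = ℕ → Carrier

  const : Carrier → Series
  const r zero    = r
  const r (suc _) = 0#

  ε : Series
  ε (suc zero) = 1#
  ε _          = 0#

  rawRing : RawRing c ℓ
  rawRing = record
    { Carrier = Series
    ; _≈_     = λ f g → ∀ k → f k ≈ g k
    ; _+_     = λ f g k → f k + g k
    ; _*_     = λ f g k → sum {suc k} λ i → f (toℕ i) * g (k ∸ toℕ i)
    ; -_      = λ f k → - f k
    ; 0#      = const 0#
    ; 1#      = const 1#
    }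

-- Formal fractions. A zero denominator is allowed here and is excluded
-- separately (see Defined below). Over an integral domain the operations
-- yield a nonzero denominator only if the denominators of all the fractions
-- they are applied to are nonzero.
module Fractions (R : RawRing c ℓ) where
  open RawRing R

  infix 7 _⁄_

  record Fraction : Set c where
    constructor _⁄_
    field
      num den : Carrier

  open Fraction public

  fromRing : Carrier → Fraction
  fromRing r = r ⁄ 1#

  rawRing : RawRing c ℓ
  rawRing = record
    { Carrier = Fraction
    ; _≈_     = λ q r → num q * den r ≈ num r * den q
    ; _+_     = λ q r → (num q * den r + num r * den q) ⁄ (den q * den r)
    ; _*_     = λ q r → (num q * num r) ⁄ (den q * den r)
    ; -_      = λ q → (- num q) ⁄ den q
    ; 0#      = 0# ⁄ 1#
    ; 1#      = 1# ⁄ 1#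
    }

module Coordinates (R : RawRing c ℓ) where
  open RawRing R
  open RawSemiringDefs rawSemiring using (product) renaming (_×_ to _·_)
  open Fractions R using (Fraction; _⁄_; fromRing)
  private
    module F where
      open RawRing (Fractions.rawRing R) public
      open RawSemiringDefs (RawRing.rawSemiring (Fractions.rawRing R)) public using (sum; product)

  infixl 6 _-_
  _-_ : Carrier → Carrier → Carrier
  r - t = r + (- t)

  W : (Λ x : Fin n → Carrier) (s : Carrier) → Fin n → Carrier
  W Λ x s j =
      product (λ l → if does (l <? j) then s - x l + Λ l else 1#)
    * product (λ l → if does (j <? l) then s - x l else 1#)

  Φ : (κ : Fraction) (a : Carrier) (Λ x : Fin n → Carrier) (s : Carrier) → Fraction
  Φ κ a Λ x s = κ F.* F.product λ l → (s - x l + Λ l) ⁄ (s - x l + a)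

  J : (p : ℕ) (κ : Fraction) (a : Carrier) (Λ x : Fin n → Carrier) (s : Carrier) →
      Fin n → Fraction
  J p κ a Λ x s k = F.sum {p} λ d →
        fromRing (W Λ x (s + toℕ d · a) k)
    F.* F.product {toℕ d} λ j → Φ κ a Λ x (s + toℕ j · a)

module _ (R : CommutativeRing c ℓ) (V : Module R m ℓm) where
  open CommutativeRing R using (Carrier; _≈_; 0#)
  open Module V

  linearCombination : (Fin n → Carrier) → (Fin n → Carrierᴹ) → Carrierᴹ
  linearCombination r v = RawMonoidDefs.sum +ᴹ-rawMonoid λ i → r i *ₗ v i

  record IsBasis (v : Fin n → Carrierᴹ) : Set (c ⊔ ℓ ⊔ m ⊔ ℓm) where
    field
      linearlyIndependent : ∀ r → linearCombination r v ≈ᴹ 0ᴹ → ∀ i → r i ≈ 0#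
      spanning            : ∀ u → ∃[ r ] u ≈ᴹ linearCombination r v

module OverField (K : HeytingField c ℓ₁ ℓ₂) where
  open HeytingField K using (heytingCommutativeRing; _#_)

  commutativeRing : CommutativeRing c ℓ₁
  commutativeRing = HeytingCommutativeRing.commutativeRing heytingCommutativeRing

  open CommutativeRing commutativeRing
  open RawSemiringDefs (RawRing.rawSemiring rawRing) using () renaming (_×_ to _·_)

  HasCharacteristic : ℕ → Set ℓ₁
  HasCharacteristic p = ∀ k → (k · 1# ≈ 0#) ⇔ (p ∣ k)

  -- In positive characteristic the natural multiples of 1 already form a
  -- subfield.
  _∈𝔽ₚ : Carrier → Set ℓ₁
  r ∈𝔽ₚ = ∃[ k ] r ≈ k · 1#

  _∈𝔽ₚˣ : Carrier → Set (ℓ₁ ⊔ ℓ₂)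
  r ∈𝔽ₚˣ = r ∈𝔽ₚ × r # 0#

  -- coeff₁ s + coeff₀, as a polynomial in s.
  record LinearPoly : Set c where
    field
      coeff₁ coeff₀ : Carrier

  open LinearPoly

  _#ᴾ_ : LinearPoly → LinearPoly → Set ℓ₂
  f #ᴾ g = coeff₁ f # coeff₁ g ⊎ coeff₀ f # coeff₀ g

  module _ {p n : ℕ} (a : Carrier) (Λ x : Fin n → Carrier) where

    factor : (Fin n × Fin p) ⊎ (Fin n × Fin p) → LinearPoly
    factor (inj₁ (i , j)) = record { coeff₁ = 1# ; coeff₀ = - x i + Λ i + toℕ j · a }
    factor (inj₂ (i , j)) = record { coeff₁ = 1# ; coeff₀ = - x i + toℕ j · a }

    FactorsDistinct : Set ℓ₂
    FactorsDistinct = ∀ u v → u ≢ v → factor u #ᴾ factor v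

  open PowerSeries rawRing public using (Series; const; ε)

  K[[ε]] : RawRing c ℓ₁
  K[[ε]] = PowerSeries.rawRing rawRing

  open Fractions K[[ε]] public using (Fraction; _⁄_; num; den; fromRing)
  open RawRing K[[ε]] public using () renaming (_≈_ to _≈ˢ_)
  open RawRing (Fractions.rawRing K[[ε]]) public using () renaming (_≈_ to _≈ᶠ_)
  open Coordinates rawRing public using (W)

  private
    module S where
      open RawRing K[[ε]] public
      open Coordinates K[[ε]] public using (_-_; J)
      open RawSemiringDefs (RawRing.rawSemiring K[[ε]]) public using (product; _^_)

  record IsBranch (p : ℕ) (a : Carrier) (Λ x : Fin n → Carrier) (y : Carrier)
                  (s : Series) : Set ℓ₁ where
    field
      initial  : s 0 ≈ y
      equation :
        (S.product λ l → S.product {p} λ j →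
           s S.- const (x l) S.+ const (Λ l) S.+ const (toℕ j · a))
        ≈ˢ
        ε S.^ p S.*
        (S.product λ l → S.product {p} λ j →
           s S.- const (x l) S.+ const (toℕ j · a))

  -- The coordinates in Frac K[[ε]] = K((ε)) of J(s(ε), x), with κ = ε⁻¹.
  pullbackJ : (p : ℕ) (a : Carrier) (Λ x : Fin n → Carrier) (s : Series) →
              Fin n → Fraction
  pullbackJ p a Λ x s =
    S.J p (S.1# ⁄ ε) (const a) (λ l → const (Λ l)) (λ l → const (x l)) s

  Defined : Fraction → Set ℓ₂
  Defined q = ∃[ k ] den q k # 0#

  _≐_ : Fraction → Series → Set (ℓ₁ ⊔ ℓ₂)
  q ≐ g = Defined q × q ≈ᶠ fromRing g

  Regular : (Fin n → Fraction) → Set (c ⊔ ℓ₁ ⊔ ℓ₂)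
  Regular q = ∀ k → ∃[ g ] q k ≐ g

  _≐_+O[ε] : (Fin n → Fraction) → (Fin n → Carrier) → Set (c ⊔ ℓ₁ ⊔ ℓ₂)
  q ≐ w +O[ε] = ∀ k → ∃[ h ] q k ≐ (const (w k) S.+ ε S.* h)

{-# OPTIONS --safe #-}
-- Dividing the branch equation by the factors that do not vanish at yᵢ turns it
-- into a contracting fixed-point equation s = yᵢ + εᵖ(…), so sᵢ exists, is unique
-- and agrees with yᵢ modulo εᵖ.  Hence the factor s − xᵢ + Λᵢ of Φ(s, x) has a zero
-- of order p, which cancels the pole κᵈ = ε⁻ᵈ of every summand d ≥ 1 of J and
-- leaves W(yᵢ) modulo ε.  Since W_j(yᵢ) contains the factor yᵢ − yᵢ for i < j, the
-- vectors W(yᵢ) are triangular with respect to f, with nonzero diagonal.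
module Submission where

open import Defs
open import Level using (_⊔_)
open import Algebra.Apartness.Bundles using (HeytingField)
import Algebra.Apartness.Properties.HeytingCommutativeRing as HeytingProperties
open import Algebra.Bundles using (CommutativeRing)
open import Algebra.Bundles.Raw using (RawRing)
import Algebra.Definitions.RawSemiring as RawSemiringDefs
open import Algebra.Module.Bundles using (Module)
import Algebra.Properties.CommutativeMonoid.Sum as CommutativeMonoidSum
import Algebra.Properties.Ring as RingProperties
import Algebra.Properties.Semiring.Exp as SemiringExp
import Algebra.Properties.Semiring.Sum as SemiringSum
import Algebra.Solver.CommutativeMonoid as CommutativeMonoidSolver
open import Data.Bool.Base using (true; false; if_then_else_)
open import Data.Fin.Base as Fin using (Fin; zero; suc; toℕ; punchIn)
import Data.Fin.Properties as Fin
open import Data.Nat.Base as ℕ using (ℕ; zero; suc; _<_; _≤_; _∸_; z≤n; s≤s)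
import Data.Nat.Properties as ℕ
open import Data.Product using (_×_; _,_; proj₁; proj₂; ∃-syntax; ∃!)
open import Data.Sum.Base using (_⊎_; inj₁; inj₂)
open import Data.Vec.Functional using (removeAt)
open import Function.Base using (_∘_)
open import Relation.Binary.PropositionalEquality.Core as ≡ using (_≡_; _≢_)
import Relation.Binary.Reasoning.Setoid as SetoidReasoning
open import Relation.Nullary.Decidable using (Dec; does; yes; no; dec-true)
open import Relation.Nullary.Negation.Core using (¬_; contradiction)

-- The poles of J along a branch come from κ alone: the denominator of Φ at the shift ja is s - xₗ +
-- (j+1)a, a factor of the right-hand side of the branch equation, and distinctness keeps it nonzero
-- at yᵢ. The summand d uses Φ at d ≤ p - 1 points, so its pole has order at most p - 1, one less
-- than the guaranteed order of the zero; this is the ε that survives in the remainder. The field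
-- has an apartness relation but no decidable equality, so the order of a series cannot be computed.
-- Orders are carried as explicit factors εᵐ, and nonvanishing as apartness from zero or an explicit
-- inverse. Inverses of series come from the same contraction principle as the branch itself. Formal
-- fractions may have denominator zero, so each estimate on a fraction also records that its
-- denominator is a power of ε times a unit.

module RingLemmas {c ℓ} (R : CommutativeRing c ℓ) where
  open CommutativeRing R
  open RingProperties ring
  open SetoidReasoning setoid

  -- The right inverse of u₀ + e u′ solves a fixed-point equation that is
  -- contracting when e is the variable of a power series ring.
  fixedPoint⇒inverse : ∀ {u u₀ u′ c e v} → u ≈ u₀ + e * u′ → c * u₀ ≈ 1# →
                       v ≈ c * (1# - e * (u′ * v)) → u * v ≈ 1#
  fixedPoint⇒inverse {u} {u₀} {u′} {c} {e} {v} u≈ cu₀≈1 v≈ = begin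
    u * v                                    ≈⟨ *-congʳ u≈ ⟩
    (u₀ + e * u′) * v                        ≈⟨ distribʳ v u₀ (e * u′) ⟩
    u₀ * v + e * u′ * v                      ≈⟨ +-cong (*-congˡ v≈) (*-assoc e u′ v) ⟩
    u₀ * (c * (1# - w)) + w                  ≈⟨ +-congʳ (*-assoc u₀ c _) ⟨
    u₀ * c * (1# - w) + w                    ≈⟨ +-congʳ (*-congʳ (trans (*-comm u₀ c) cu₀≈1)) ⟩
    1# * (1# - w) + w                        ≈⟨ +-congʳ (*-identityˡ _) ⟩
    1# - w + w                               ≈⟨ //-rightDividesˡ w 1# ⟩
    1#                                       ∎
    where w = e * (u′ * v)

  divide : ∀ {z u v w} → u * v ≈ 1# → z * u ≈ w → z ≈ w * v
  divide {z} {u} {v} {w} uv≈1 zu≈w = begin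
    z            ≈⟨ *-identityʳ z ⟨
    z * 1#       ≈⟨ *-congˡ uv≈1 ⟨
    z * (u * v)  ≈⟨ *-assoc z u v ⟨
    z * u * v    ≈⟨ *-congʳ zu≈w ⟩
    w * v        ∎

  undivide : ∀ {z u v w} → u * v ≈ 1# → z ≈ w * v → z * u ≈ w
  undivide {z} {u} {v} {w} uv≈1 z≈wv = begin
    z * u        ≈⟨ *-congʳ z≈wv ⟩
    w * v * u    ≈⟨ *-assoc w v u ⟩
    w * (v * u)  ≈⟨ *-congˡ (trans (*-comm v u) uv≈1) ⟩
    w * 1#       ≈⟨ *-identityʳ w ⟩
    w            ∎

  x-y≈z⇒x≈y+z : ∀ {x y z} → x - y ≈ z → x ≈ y + z
  x-y≈z⇒x≈y+z {x} {y} {z} x-y≈z = begin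
    x            ≈⟨ //-rightDividesˡ y x ⟨
    x - y + y    ≈⟨ +-comm _ y ⟩
    y + (x - y)  ≈⟨ +-congˡ x-y≈z ⟩
    y + z        ∎

  x≈y+z⇒x-y≈z : ∀ {x y z} → x ≈ y + z → x - y ≈ z
  x≈y+z⇒x-y≈z {x} {y} {z} x≈y+z = trans (+-congʳ x≈y+z) (xyx⁻¹≈y y z)

  x-[y-z]≈x-y+z : ∀ x y z → x - (y - z) ≈ x - y + z
  x-[y-z]≈x-y+z x y z = begin
    x - (y - z)          ≈⟨ +-congˡ (-‿+-comm y (- z)) ⟨
    x + (- y - - z)      ≈⟨ +-congˡ (+-congˡ (-‿involutive z)) ⟩
    x + (- y + z)        ≈⟨ +-assoc x (- y) z ⟨
    x - y + z            ∎

-- The ring of formal power series over a commutative ring.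

module PowerSeriesRing {c ℓ} (R : CommutativeRing c ℓ) where
  open CommutativeRing R
  open SemiringSum semiring using (sum-cong-≋; ∑-distrib-+; *-distribˡ-sum)
  open PowerSeries rawRing using (Series; const; ε) renaming (rawRing to rawRingˢ)
  open RawRing rawRingˢ public using ()
    renaming (_≈_ to _≈ˢ_; _+_ to _+ˢ_; _*_ to _*ˢ_; -_ to -ˢ_; 0# to 0ˢ; 1# to 1ˢ)
  open SetoidReasoning setoid

  tail : Series → Series
  tail f = f ∘ suc

  infix 4 _≡[_]_

  -- Congruence modulo εᵏ. It takes the place of the ε-adic distance and needs no decision about
  -- which coefficients vanish.
  _≡[_]_ : Series → ℕ → Series → Set ℓ
  f ≡[ k ] g = ∀ {j} → j < k → f j ≈ g j

  ≡[]⇒≈ˢ : ∀ {f g} → (∀ k → f ≡[ k ] g) → f ≈ˢ g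
  ≡[]⇒≈ˢ f≡g k = f≡g (suc k) ℕ.≤-refl

  ≡[]-mono : ∀ {f g j k} → j ≤ k → f ≡[ k ] g → f ≡[ j ] g
  ≡[]-mono j≤k f≡g i<j = f≡g (ℕ.<-≤-trans i<j j≤k)

  *ˢ-cong-≡[] : ∀ {f f′ g g′ k} → f ≡[ k ] f′ → g ≡[ k ] g′ → f *ˢ g ≡[ k ] f′ *ˢ g′
  *ˢ-cong-≡[] f≡f′ g≡g′ {j} j<k = sum-cong-≋ {suc j} λ i → *-cong
    (f≡f′ (ℕ.≤-<-trans (Fin.toℕ≤pred[n] i) j<k))
    (g≡g′ (ℕ.≤-<-trans (ℕ.m∸n≤m j (toℕ i)) j<k))

  *ˢ-cong : ∀ {f f′ g g′} → f ≈ˢ f′ → g ≈ˢ g′ → f *ˢ g ≈ˢ f′ *ˢ g′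
  *ˢ-cong f≈f′ g≈g′ k = sum-cong-≋ {suc k} λ i → *-cong (f≈f′ (toℕ i)) (g≈g′ (k ∸ toℕ i))

  *ˢ-distribʳ : ∀ f g h → (g +ˢ h) *ˢ f ≈ˢ g *ˢ f +ˢ h *ˢ f
  *ˢ-distribʳ f g h k = trans
    (sum-cong-≋ {suc k} λ i → distribʳ (f (k ∸ toℕ i)) (g (toℕ i)) (h (toℕ i)))
    (∑-distrib-+ {suc k} (λ i → g (toℕ i) * f (k ∸ toℕ i)) (λ i → h (toℕ i) * f (k ∸ toℕ i)))

  scale-*ˢ : ∀ r f g k → ((λ j → r * f j) *ˢ g) k ≈ r * (f *ˢ g) k
  scale-*ˢ r f g k = trans
    (sum-cong-≋ {suc k} λ i → *-assoc r (f (toℕ i)) (g (k ∸ toℕ i)))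
    (sym (*-distribˡ-sum {suc k} r (λ i → f (toℕ i) * g (k ∸ toℕ i))))

  -- Induction on the coefficient. By computation the Cauchy product obeys `tail (f *ˢ g)` = f 0 ·
  -- `tail g` + `tail f *ˢ g`, so distributivity and `scale-*ˢ` reduce the claim to the one for
  -- `tail f`.
  *ˢ-assoc : ∀ f g h → (f *ˢ g) *ˢ h ≈ˢ f *ˢ (g *ˢ h)
  *ˢ-assoc f g h zero = begin
    (f 0 * g 0 + 0#) * h 0 + 0#    ≈⟨ +-congʳ (*-congʳ (+-identityʳ _)) ⟩
    f 0 * g 0 * h 0 + 0#           ≈⟨ +-congʳ (*-assoc _ _ _) ⟩
    f 0 * (g 0 * h 0) + 0#         ≈⟨ +-congʳ (*-congˡ (+-identityʳ _)) ⟨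
    f 0 * (g 0 * h 0 + 0#) + 0#    ∎
  *ˢ-assoc f g h (suc k) = begin
    (f 0 * g 0 + 0#) * h (suc k) + (tail (f *ˢ g) *ˢ h) k
      ≈⟨ +-cong (trans (*-congʳ (+-identityʳ _)) (*-assoc _ _ _))
                (*ˢ-distribʳ h (λ j → f 0 * tail g j) (tail f *ˢ g) k) ⟩
    f 0 * (g 0 * h (suc k)) + (((λ j → f 0 * tail g j) *ˢ h) k + ((tail f *ˢ g) *ˢ h) k)
      ≈⟨ +-congˡ (+-cong (scale-*ˢ (f 0) (tail g) h k) (*ˢ-assoc (tail f) g h k)) ⟩
    f 0 * (g 0 * h (suc k)) + (f 0 * (tail g *ˢ h) k + (tail f *ˢ (g *ˢ h)) k)
      ≈⟨ +-assoc _ _ _ ⟨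
    f 0 * (g 0 * h (suc k)) + f 0 * (tail g *ˢ h) k + (tail f *ˢ (g *ˢ h)) k
      ≈⟨ +-congʳ (distribˡ _ _ _) ⟨
    f 0 * (g *ˢ h) (suc k) + (tail f *ˢ (g *ˢ h)) k ∎

  -- The mirror image of the recursion that the Cauchy product satisfies by computation: the last
  -- term is split off instead of the first. Comparing the two recursions gives commutativity.
  *ˢ-last : ∀ f g k → (f *ˢ g) (suc k) ≈ f (suc k) * g 0 + (f *ˢ tail g) k
  *ˢ-last f g zero = begin
    f 0 * g 1 + (f 1 * g 0 + 0#)  ≈⟨ +-congˡ (+-identityʳ _) ⟩
    f 0 * g 1 + f 1 * g 0         ≈⟨ +-comm _ _ ⟩
    f 1 * g 0 + f 0 * g 1         ≈⟨ +-congˡ (+-identityʳ _) ⟨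
    f 1 * g 0 + (f 0 * g 1 + 0#)  ∎
  *ˢ-last f g (suc k) = begin
    f 0 * g (2 ℕ.+ k) + (tail f *ˢ g) (suc k)
      ≈⟨ +-congˡ (*ˢ-last (tail f) g k) ⟩
    f 0 * g (2 ℕ.+ k) + (f (2 ℕ.+ k) * g 0 + (tail f *ˢ tail g) k)
      ≈⟨ +-assoc _ _ _ ⟨
    f 0 * g (2 ℕ.+ k) + f (2 ℕ.+ k) * g 0 + (tail f *ˢ tail g) k
      ≈⟨ +-congʳ (+-comm _ _) ⟩
    f (2 ℕ.+ k) * g 0 + f 0 * g (2 ℕ.+ k) + (tail f *ˢ tail g) k
      ≈⟨ +-assoc _ _ _ ⟩
    f (2 ℕ.+ k) * g 0 + (f 0 * g (2 ℕ.+ k) + (tail f *ˢ tail g) k) ∎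

  *ˢ-comm : ∀ f g → f *ˢ g ≈ˢ g *ˢ f
  *ˢ-comm f g zero    = +-congʳ (*-comm _ _)
  *ˢ-comm f g (suc k) = begin
    f 0 * g (suc k) + (tail f *ˢ g) k  ≈⟨ +-cong (*-comm _ _) (*ˢ-comm (tail f) g k) ⟩
    g (suc k) * f 0 + (g *ˢ tail f) k  ≈⟨ *ˢ-last g f k ⟨
    (g *ˢ f) (suc k)                   ∎

  0ˢ≈0 : ∀ k → 0ˢ k ≈ 0#
  0ˢ≈0 zero    = refl
  0ˢ≈0 (suc k) = refl

  *ˢ-zeroˡ : ∀ f k → ((λ _ → 0#) *ˢ f) k ≈ 0#
  *ˢ-zeroˡ f zero    = trans (+-identityʳ _) (zeroˡ _)
  *ˢ-zeroˡ f (suc k) = trans (+-cong (zeroˡ _) (*ˢ-zeroˡ f k)) (+-identityʳ _)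

  *ˢ-identityˡ : ∀ f → 1ˢ *ˢ f ≈ˢ f
  *ˢ-identityˡ f zero    = trans (+-identityʳ _) (*-identityˡ _)
  *ˢ-identityˡ f (suc k) = trans (+-cong (*-identityˡ _) (*ˢ-zeroˡ f k)) (+-identityʳ _)

  commutativeRingˢ : CommutativeRing c ℓ
  commutativeRingˢ = record
    { Carrier = Series ; _≈_ = _≈ˢ_ ; _+_ = _+ˢ_ ; _*_ = _*ˢ_ ; -_ = -ˢ_ ; 0# = 0ˢ ; 1# = 1ˢ
    ; isCommutativeRing = record
      { isRing = record
        { +-isAbelianGroup = record
          { isGroup = record
            { isMonoid = record
              { isSemigroup = record
                { isMagma = record
                  { isEquivalence = record
                    { refl  = λ _ → refl
                    ; sym   = λ p k → sym (p k)
                    ; trans = λ p q k → trans (p k) (q k)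
                    }
                  ; ∙-cong = λ p q k → +-cong (p k) (q k)
                  }
                ; assoc = λ f g h k → +-assoc _ _ _
                }
              ; identity = (λ f k → trans (+-congʳ (0ˢ≈0 k)) (+-identityˡ _))
                         , (λ f k → trans (+-congˡ (0ˢ≈0 k)) (+-identityʳ _))
              }
            ; inverse = (λ f k → trans (-‿inverseˡ _) (sym (0ˢ≈0 k)))
                      , (λ f k → trans (-‿inverseʳ _) (sym (0ˢ≈0 k)))
            ; ⁻¹-cong = λ p k → -‿cong (p k)
            }
          ; comm = λ f g k → +-comm _ _
          }
        ; *-cong = λ {f} {f′} {g} {g′} → *ˢ-cong {f} {f′} {g} {g′}
        ; *-assoc = *ˢ-assoc
        ; *-identity = *ˢ-identityˡ
                     , λ f k → trans (*ˢ-comm f 1ˢ k) (*ˢ-identityˡ f k)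
        ; distrib = (λ f g h k → trans (*ˢ-comm f (g +ˢ h) k)
                      (trans (*ˢ-distribʳ f g h k)
                        (+-cong (*ˢ-comm g f k) (*ˢ-comm h f k))))
                  , *ˢ-distribʳ
        }
      ; *-comm = *ˢ-comm
      }
    }

  *ˢ-constantTerm : ∀ f g → (f *ˢ g) 0 ≈ f 0 * g 0
  *ˢ-constantTerm f g = +-identityʳ _

  ε-*ˢ-zero : ∀ f → (ε *ˢ f) 0 ≈ 0#
  ε-*ˢ-zero f = trans (+-identityʳ _) (zeroˡ _)

  ε-*ˢ-suc : ∀ f k → (ε *ˢ f) (suc k) ≈ f k
  ε-*ˢ-suc f k = begin
    0# * f (suc k) + (tail ε *ˢ f) k
      ≈⟨ +-cong (zeroˡ _) (*ˢ-cong {tail ε} {1ˢ} {f} {f} tail-ε (λ _ → refl) k) ⟩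
    0# + (1ˢ *ˢ f) k                  ≈⟨ +-identityˡ _ ⟩
    (1ˢ *ˢ f) k                       ≈⟨ *ˢ-identityˡ f k ⟩
    f k                               ∎
    where
    tail-ε : tail ε ≈ˢ 1ˢ
    tail-ε zero    = refl
    tail-ε (suc j) = refl

  ε-*ˢ-cong : ∀ {f g k} → f ≡[ k ] g → ε *ˢ f ≡[ suc k ] ε *ˢ g
  ε-*ˢ-cong {f} {g} f≡g {zero}  _         = trans (ε-*ˢ-zero f) (sym (ε-*ˢ-zero g))
  ε-*ˢ-cong {f} {g} f≡g {suc j} (s≤s j<k) =
    trans (ε-*ˢ-suc f j) (trans (f≡g j<k) (sym (ε-*ˢ-suc g j)))

  -- Multiplication by ε is a shift of coefficients. This is the one cancellation law that the
  -- calculus of fractions takes as input.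
  ε-*ˢ-cancelˡ : ∀ f g → ε *ˢ f ≈ˢ ε *ˢ g → f ≈ˢ g
  ε-*ˢ-cancelˡ f g εf≈εg k =
    trans (sym (ε-*ˢ-suc f k)) (trans (εf≈εg (suc k)) (ε-*ˢ-suc g k))

  constantTerm+tail : ∀ f → f ≈ˢ const (f 0) +ˢ ε *ˢ tail f
  constantTerm+tail f zero    = sym (trans (+-congˡ (ε-*ˢ-zero (tail f))) (+-identityʳ _))
  constantTerm+tail f (suc k) = sym (trans (+-congˡ (ε-*ˢ-suc (tail f) k)) (+-identityˡ _))

  -- Contractions in the ε-adic metric: fixed points and inverses.

  Contracting : (Series → Series) → Set (c ⊔ ℓ)
  Contracting T = ∀ {f g k} → f ≡[ k ] g → T f ≡[ suc k ] T g

  iterate : (Series → Series) → ℕ → Series → Series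
  iterate T zero    f = f
  iterate T (suc k) f = T (iterate T k f)

  abstract
    -- Under a contraction the coefficient at k is stable from the iteration k + 1 on, so the limit
    -- can be read off along the diagonal.
    fix : (Series → Series) → Series
    fix T k = iterate T (suc k) 0ˢ k

  module _ {T : Series → Series} (contracting : Contracting T) where

    iterate-≡[] : ∀ k f g → iterate T k f ≡[ k ] iterate T k g
    iterate-≡[] zero    f g ()
    iterate-≡[] (suc k) f g = contracting (iterate-≡[] k f g)

    iterate-+ : ∀ k m f → iterate T (k ℕ.+ m) f ≡ iterate T k (iterate T m f)
    iterate-+ zero    m f = ≡.refl
    iterate-+ (suc k) m f = ≡.cong T (iterate-+ k m f)

    abstract
      fix-≡[] : ∀ k → fix T ≡[ k ] iterate T k 0ˢ
      fix-≡[] k {j} j<k with ℕ.m≤n⇒∃[o]m+o≡n j<k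
      ... | m , ≡.refl = begin
        -- The first `suc j` iterations counted from the outside determine the coefficient `j`
        -- whatever the start, so the start may be moved to the `m`-th iterate.
        iterate T (suc j) 0ˢ j                  ≈⟨ iterate-≡[] (suc j) 0ˢ (iterate T m 0ˢ) ℕ.≤-refl ⟩
        iterate T (suc j) (iterate T m 0ˢ) j    ≡⟨ ≡.cong (λ f → f j) (iterate-+ (suc j) m 0ˢ) ⟨
        iterate T (suc j ℕ.+ m) 0ˢ j            ∎

    fix-fixed : fix T ≈ˢ T (fix T)
    fix-fixed k = trans (fix-≡[] (suc k) ℕ.≤-refl) (sym (contracting (fix-≡[] k) ℕ.≤-refl))

    fixedPoint-unique : ∀ {f g} → f ≈ˢ T f → g ≈ˢ T g → f ≈ˢ g
    fixedPoint-unique {f} {g} f≈Tf g≈Tg = ≡[]⇒≈ˢ {f} {g} λ k {j} → go k {j}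
      where
      go : ∀ k → f ≡[ k ] g
      go zero    ()
      go (suc k) {j} j<k = trans (f≈Tf j) (trans (contracting (go k) j<k) (sym (g≈Tg j)))

  module _ (c : Carrier) where

    -- With u = u₀ + ε · `tail u`, the equation u v = 1 reads u₀ v = 1 - ε · `tail u` · v;
    -- multiplying by c = 1/u₀ gives the fixed-point form.
    inverseStep : Series → Series → Series
    inverseStep u v = const c *ˢ (1ˢ +ˢ -ˢ (ε *ˢ (tail u *ˢ v)))

    -- Inverts u only if c is inverse to its constant term.
    inverse : Series → Series
    inverse u = fix (inverseStep u)

    inverseStep-cong : ∀ {u u′ v v′ k} → u ≡[ suc k ] u′ → v ≡[ k ] v′ →
                       inverseStep u v ≡[ suc k ] inverseStep u′ v′
    inverseStep-cong {u} {u′} {v} {v′} {k} u≡u′ v≡v′ =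
      *ˢ-cong-≡[] {const c} {const c} {1ˢ +ˢ -ˢ (ε *ˢ w)} {1ˢ +ˢ -ˢ (ε *ˢ w′)} (λ _ → refl)
        λ j<k → +-congˡ (-‿cong (ε-*ˢ-cong {w} {w′} w≡w′ j<k))
      where
      w  = tail u *ˢ v
      w′ = tail u′ *ˢ v′

      w≡w′ : w ≡[ k ] w′
      w≡w′ = *ˢ-cong-≡[] {tail u} {tail u′} {v} {v′} (λ j<k → u≡u′ (s≤s j<k)) v≡v′

    inverseStep-contracting : ∀ u → Contracting (inverseStep u)
    inverseStep-contracting u {f} {g} = inverseStep-cong {u} {u} {f} {g} (λ _ → refl)

    -- The same c serves both series and neither has to be invertible. This lets the step in
    -- `Hensel` contract on all series, including those whose constant term is not y.
    inverse-cong : ∀ {u u′ k} → u ≡[ k ] u′ → inverse u ≡[ k ] inverse u′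
    inverse-cong {u} {u′} {zero}  u≡u′ ()
    inverse-cong {u} {u′} {suc k} u≡u′ {j} j<k = begin
      inverse u j                     ≈⟨ fix-fixed (inverseStep-contracting u) j ⟩
      inverseStep u (inverse u) j     ≈⟨ inverseStep-cong {u} {u′} u≡u′
                                           (inverse-cong {u} {u′} (≡[]-mono {u} {u′} (ℕ.n≤1+n k) u≡u′)) j<k ⟩
      inverseStep u′ (inverse u′) j   ≈⟨ fix-fixed (inverseStep-contracting u′) j ⟨
      inverse u′ j                    ∎

    const-* : ∀ r → const c *ˢ const r ≈ˢ const (c * r)
    const-* r zero    = +-identityʳ _
    const-* r (suc k) = trans (+-cong (zeroʳ c) (*ˢ-zeroˡ (const r) k)) (+-identityʳ _)

    inverse-inverseʳ : ∀ u → c * u 0 ≈ 1# → u *ˢ inverse u ≈ˢ 1ˢ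
    inverse-inverseʳ u cu₀≈1 = RingLemmas.fixedPoint⇒inverse commutativeRingˢ
      {u} {const (u 0)} {tail u} {const c} {ε} {inverse u}
      (constantTerm+tail u)
      (λ k → trans (const-* (u 0) k) (const-cong k))
      (fix-fixed (inverseStep-contracting u))
      where
      const-cong : const (c * u 0) ≈ˢ 1ˢ
      const-cong zero    = cu₀≈1
      const-cong (suc k) = refl

  -- Hensel's lemma for equations (s - y) U(s) = ε Q(s).

  Nonexpansive : (Series → Series) → Set (c ⊔ ℓ)
  Nonexpansive F = ∀ {f g k} → f ≡[ k ] g → F f ≡[ k ] F g

  -- U and Q stand for polynomials in s, of which only nonexpansiveness is kept. A single c can
  -- invert the constant term of every U(s) with s(0) = y, because that constant term depends on
  -- s(0) alone.
  module Hensel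
    (y : Carrier) (c : Carrier) (U Q : Series → Series)
    (U-nonexpansive : Nonexpansive U) (Q-nonexpansive : Nonexpansive Q)
    (U-inverse : ∀ {s} → s 0 ≈ y → c * U s 0 ≈ 1#)
    where

    IsRoot : Series → Set ℓ
    IsRoot s = s 0 ≈ y × (s +ˢ -ˢ const y) *ˢ U s ≈ˢ ε *ˢ Q s

    private
      step : Series → Series
      step s = const y +ˢ ε *ˢ (Q s *ˢ inverse c (U s))

      step-contracting : Contracting step
      step-contracting {f} {g} f≡g {j} j<k = +-congˡ
        (ε-*ˢ-cong {Q f *ˢ inverse c (U f)} {Q g *ˢ inverse c (U g)}
          (*ˢ-cong-≡[] {Q f} {Q g} (Q-nonexpansive f≡g)
             (inverse-cong c {U f} {U g} (U-nonexpansive f≡g)))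
          j<k)

    -- Besides giving the fixed-point equation, this form exhibits every power of ε in Q as a
    -- divisor of s - y, which later yields the order of the zero of Φ.
    root-factor : ∀ {s} → IsRoot s →
                  s +ˢ -ˢ const y ≈ˢ (ε *ˢ Q s) *ˢ inverse c (U s)
    root-factor {s} (s₀≈y , equation) = RingLemmas.divide commutativeRingˢ
      {s +ˢ -ˢ const y} {U s} {inverse c (U s)} {ε *ˢ Q s}
      (inverse-inverseʳ c (U s) (U-inverse s₀≈y)) equation

    private
      root⇒fixed : ∀ {s} → IsRoot s → s ≈ˢ step s
      root⇒fixed {s} root = RingLemmas.x-y≈z⇒x≈y+z commutativeRingˢ
        {s} {const y} {ε *ˢ (Q s *ˢ inverse c (U s))}
        (λ k → trans (root-factor root k) (*ˢ-assoc ε (Q s) (inverse c (U s)) k))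

      fixed⇒root : ∀ {s} → s ≈ˢ step s → IsRoot s
      fixed⇒root {s} s≈ = s₀≈y , RingLemmas.undivide commutativeRingˢ
        {s +ˢ -ˢ const y} {U s} {inverse c (U s)} {ε *ˢ Q s}
        (inverse-inverseʳ c (U s) (U-inverse s₀≈y))
        (λ k → trans (RingLemmas.x≈y+z⇒x-y≈z commutativeRingˢ
                        {s} {const y} {ε *ˢ (Q s *ˢ inverse c (U s))} s≈ k)
                     (sym (*ˢ-assoc ε (Q s) (inverse c (U s)) k)))
        where
        -- The constant term has to be settled before the equation: only then does `U-inverse` make
        -- `U s` invertible.
        s₀≈y : s 0 ≈ y
        s₀≈y = trans (s≈ 0) (trans (+-congˡ (ε-*ˢ-zero (Q s *ˢ inverse c (U s)))) (+-identityʳ y))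

    root : Series
    root = fix step

    root-isRoot : IsRoot root
    root-isRoot = fixed⇒root {root} (fix-fixed (λ {f} {g} {k} → step-contracting {f} {g} {k}))

    root-unique : ∀ {s s′} → IsRoot s → IsRoot s′ → s ≈ˢ s′
    root-unique {s} {s′} root root′ =
      fixedPoint-unique (λ {f} {g} {k} → step-contracting {f} {g} {k}) {s} {s′}
        (root⇒fixed root) (root⇒fixed root′)

-- Fractions with denominator a power of t times a unit, and their order in t.

module FractionOrder {c ℓ} (R : CommutativeRing c ℓ)
  (t : CommutativeRing.Carrier R)
  (t-cancelˡ : ∀ x y → CommutativeRing._≈_ R (CommutativeRing._*_ R t x) (CommutativeRing._*_ R t y) →
               CommutativeRing._≈_ R x y)
  where
  open CommutativeRing R hiding (zero)
  open SemiringExp semiring using (_^_; ^-homo-*)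
  open CommutativeMonoidSolver *-commutativeMonoid using (solve; _⊕_; _⊜_)
  open SetoidReasoning setoid
  open Fractions rawRing using (Fraction; _⁄_; num; den; fromRing)
  private
    module F where
      open RawRing (Fractions.rawRing rawRing) public
      open RawSemiringDefs (RawRing.rawSemiring (Fractions.rawRing rawRing)) public
        using (sum; product)

  Unit : Carrier → Set (c ⊔ ℓ)
  Unit u = ∃[ v ] u * v ≈ 1#

  -- This class contains the denominator t of κ and the unit denominators of Φ, and it is closed
  -- under products. Its members are nonzero for an explicit reason, so no argument about zero
  -- divisors is called for.
  PowerTimesUnit : Carrier → Set (c ⊔ ℓ)
  PowerTimesUnit r = ∃[ k ] ∃[ u ] Unit u × r ≈ t ^ k * u

  Unit-1 : Unit 1#
  Unit-1 = 1# , *-identityʳ 1#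

  Unit-* : ∀ {r s} → Unit r → Unit s → Unit (r * s)
  Unit-* {r} {s} (r⁻¹ , rr⁻¹≈1) (s⁻¹ , ss⁻¹≈1) = r⁻¹ * s⁻¹ , (begin
    r * s * (r⁻¹ * s⁻¹)
      ≈⟨ solve 4 (λ a b c d → (a ⊕ b) ⊕ (c ⊕ d) ⊜ (a ⊕ c) ⊕ (b ⊕ d)) refl r s r⁻¹ s⁻¹ ⟩
    r * r⁻¹ * (s * s⁻¹)   ≈⟨ *-cong rr⁻¹≈1 ss⁻¹≈1 ⟩
    1# * 1#               ≈⟨ *-identityʳ 1# ⟩
    1#                    ∎)

  Unit⇒PowerTimesUnit : ∀ {u} → Unit u → PowerTimesUnit u
  Unit⇒PowerTimesUnit {u} unit = 0 , u , unit , sym (*-identityˡ u)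

  PowerTimesUnit-t : PowerTimesUnit t
  PowerTimesUnit-t = 1 , 1# , Unit-1 , sym (trans (*-identityʳ _) (*-identityʳ t))

  PowerTimesUnit-* : ∀ {r s} → PowerTimesUnit r → PowerTimesUnit s → PowerTimesUnit (r * s)
  PowerTimesUnit-* {r} {s} (k , u , unit , r≈) (l , v , unit′ , s≈) =
    k ℕ.+ l , u * v , Unit-* unit unit′ , (begin
      r * s                       ≈⟨ *-cong r≈ s≈ ⟩
      (t ^ k * u) * (t ^ l * v)
        ≈⟨ solve 4 (λ a b c d → (a ⊕ b) ⊕ (c ⊕ d) ⊜ (a ⊕ c) ⊕ (b ⊕ d)) refl (t ^ k) u (t ^ l) v ⟩
      (t ^ k * t ^ l) * (u * v)   ≈⟨ *-congʳ (^-homo-* t k l) ⟨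
      t ^ (k ℕ.+ l) * (u * v)     ∎)

  t^-cancelˡ : ∀ k {x y} → t ^ k * x ≈ t ^ k * y → x ≈ y
  t^-cancelˡ zero    {x} {y} eq = trans (sym (*-identityˡ x)) (trans eq (*-identityˡ y))
  t^-cancelˡ (suc k) {x} {y} eq = t^-cancelˡ k (t-cancelˡ _ _
    (trans (sym (*-assoc t (t ^ k) x)) (trans eq (*-assoc t (t ^ k) y))))

  infix 4 _≗_

  -- The condition on the denominator gives the equation its meaning: without it, 0 ⁄ 0 would
  -- represent every ring element.
  record _≗_ (q : Fraction) (g : Carrier) : Set (c ⊔ ℓ) where
    constructor represents
    field
      den-powerTimesUnit : PowerTimesUnit (den q)
      num≈               : num q ≈ g * den q

  fromRing-≗ : ∀ r → fromRing r ≗ r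
  fromRing-≗ r = represents (Unit⇒PowerTimesUnit Unit-1) (sym (*-identityʳ r))

  +-≗ : ∀ {q r g h} → q ≗ g → r ≗ h → q F.+ r ≗ g + h
  +-≗ {q} {r} {g} {h} (represents q-den q≈) (represents r-den r≈) =
   represents (PowerTimesUnit-* q-den r-den) (begin
    num q * den r + num r * den q              ≈⟨ +-cong (*-congʳ q≈) (*-congʳ r≈) ⟩
    g * den q * den r + h * den r * den q
      ≈⟨ +-cong (*-assoc g _ _) (trans (*-assoc h _ _) (*-congˡ (*-comm _ _))) ⟩
    g * (den q * den r) + h * (den q * den r)  ≈⟨ distribʳ _ g h ⟨
    (g + h) * (den q * den r)                  ∎)

  *-≗ : ∀ {q r g h} → q ≗ g → r ≗ h → q F.* r ≗ g * h
  *-≗ {q} {r} {g} {h} (represents q-den q≈) (represents r-den r≈) =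
   represents (PowerTimesUnit-* q-den r-den) (begin
    num q * num r                ≈⟨ *-cong q≈ r≈ ⟩
    g * den q * (h * den r)
      ≈⟨ solve 4 (λ a b c d → (a ⊕ b) ⊕ (c ⊕ d) ⊜ (a ⊕ c) ⊕ (b ⊕ d)) refl g (den q) h (den r) ⟩
    g * h * (den q * den r)      ∎)

  ≗-cong : ∀ {q g h} → g ≈ h → q ≗ g → q ≗ h
  ≗-cong g≈h (represents q-den q≈) = represents q-den (trans q≈ (*-congʳ g≈h))

  scale-≗ : ∀ r q → ∃[ h ] q ≗ t * h → ∃[ h ] fromRing r F.* q ≗ t * h
  scale-≗ r q (h , q≗th) = r * h , ≗-cong
    (solve 3 (λ a b c → a ⊕ (b ⊕ c) ⊜ b ⊕ (a ⊕ c)) refl r t h)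
    (*-≗ {q = fromRing r} {r = q} (fromRing-≗ r) q≗th)

  sum-≗ : ∀ {n} {q : Fin n → Fraction} → (∀ i → ∃[ h ] q i ≗ t * h) →
          ∃[ h ] F.sum q ≗ t * h
  sum-≗ {zero}  q≗ = 0# , ≗-cong (sym (zeroʳ t)) (fromRing-≗ 0#)
  sum-≗ {suc n} q≗ with q≗ zero | sum-≗ (q≗ ∘ suc)
  ... | h , q₀≗th | h′ , q₊≗th′ = h + h′ , ≗-cong (sym (distribˡ t h h′)) (+-≗ q₀≗th q₊≗th′)

  -- q lies in tᵐ⁻ᵏ R; two exponents are kept because m ∸ k would truncate.
  record Order (k m : ℕ) (q : Fraction) : Set (c ⊔ ℓ) where
    constructor hasOrder
    field
      den-powerTimesUnit : PowerTimesUnit (den q)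
      quotient           : Carrier
      num≈               : t ^ k * num q ≈ t ^ m * quotient * den q

  Order-* : ∀ {k m k′ m′ q r} → Order k m q → Order k′ m′ r →
            Order (k ℕ.+ k′) (m ℕ.+ m′) (q F.* r)
  Order-* {k} {m} {k′} {m′} {q} {r} (hasOrder q-den g q≈) (hasOrder r-den h r≈) =
    hasOrder (PowerTimesUnit-* q-den r-den) (g * h) (begin
      t ^ (k ℕ.+ k′) * (num q * num r)               ≈⟨ *-congʳ (^-homo-* t k k′) ⟩
      t ^ k * t ^ k′ * (num q * num r)
        ≈⟨ solve 4 (λ a b c d → (a ⊕ b) ⊕ (c ⊕ d) ⊜ (a ⊕ c) ⊕ (b ⊕ d)) refl (t ^ k) (t ^ k′) (num q) (num r) ⟩
      t ^ k * num q * (t ^ k′ * num r)               ≈⟨ *-cong q≈ r≈ ⟩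
      t ^ m * g * den q * (t ^ m′ * h * den r)
        ≈⟨ solve 6 (λ a b c d e f → ((a ⊕ b) ⊕ c) ⊕ ((d ⊕ e) ⊕ f) ⊜ ((a ⊕ d) ⊕ (b ⊕ e)) ⊕ (c ⊕ f)) refl
             (t ^ m) g (den q) (t ^ m′) h (den r) ⟩
      t ^ m * t ^ m′ * (g * h) * (den q * den r)     ≈⟨ *-congʳ (*-congʳ (^-homo-* t m m′)) ⟨
      t ^ (m ℕ.+ m′) * (g * h) * (den q * den r)     ∎)

  Order-1 : Order 0 0 F.1#
  Order-1 = hasOrder (Unit⇒PowerTimesUnit Unit-1) 1# (sym (*-identityʳ _))

  Order-t⁻¹ : Order 1 0 (1# ⁄ t)
  Order-t⁻¹ = hasOrder PowerTimesUnit-t 1# (begin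
    t * 1# * 1#    ≈⟨ trans (*-identityʳ _) (*-identityʳ t) ⟩
    t              ≈⟨ *-identityˡ t ⟨
    1# * t         ≈⟨ *-congʳ (*-identityʳ 1#) ⟨
    1# * 1# * t    ∎)

  Order-⁄ : ∀ m {r g d} → r ≈ t ^ m * g → Unit d → Order 0 m (r ⁄ d)
  Order-⁄ m {r} {g} {d} r≈ (d⁻¹ , dd⁻¹≈1) =
   hasOrder (Unit⇒PowerTimesUnit (d⁻¹ , dd⁻¹≈1)) (g * d⁻¹) (begin
    1# * r                    ≈⟨ *-identityˡ r ⟩
    r                         ≈⟨ r≈ ⟩
    t ^ m * g                 ≈⟨ *-identityʳ _ ⟨
    t ^ m * g * 1#            ≈⟨ *-congˡ dd⁻¹≈1 ⟨
    t ^ m * g * (d * d⁻¹)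
      ≈⟨ solve 4 (λ a b c d → (a ⊕ b) ⊕ (c ⊕ d) ⊜ (a ⊕ (b ⊕ d)) ⊕ c) refl (t ^ m) g d d⁻¹ ⟩
    t ^ m * (g * d⁻¹) * d     ∎)

  Order-product : ∀ {n k} {q : Fin n → Fraction} → (∀ i → Order k 0 (q i)) →
                  Order (n ℕ.* k) 0 (F.product q)
  Order-product {zero}      order = Order-1
  Order-product {suc n} {k} order = Order-* (order zero) (Order-product (order ∘ suc))

  Order-product-at : ∀ {n m} {q : Fin n → Fraction} i → (∀ l → Order 0 0 (q l)) →
                     Order 0 m (q i) → Order 0 m (F.product q)
  Order-product-at {suc n} {m} {q} zero order orderᵢ =
    ≡.subst₂ (λ k m → Order k m (F.product q)) (ℕ.*-zeroʳ n) (ℕ.+-identityʳ m)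
      (Order-* {0} {m} orderᵢ (Order-product (order ∘ suc)))
  Order-product-at (suc i) order orderᵢ =
    Order-* (order zero) (Order-product-at i (order ∘ suc) orderᵢ)

  -- Cancelling tᵏ on both sides leaves tᵐ⁻ᵏ, and the strict inequality guarantees a factor t in it.
  Order⇒≗ : ∀ {k m q} → k < m → Order k m q → ∃[ h ] q ≗ t * h
  Order⇒≗ {k} {m} {q} k<m (hasOrder q-den g q≈) with ℕ.m≤n⇒∃[o]m+o≡n k<m
  ... | e , ≡.refl = t ^ e * g , represents q-den (t^-cancelˡ k (begin
    t ^ k * num q                        ≈⟨ q≈ ⟩
    t * t ^ (k ℕ.+ e) * g * den q        ≈⟨ *-congʳ (*-congʳ (*-congˡ (^-homo-* t k e))) ⟩
    t * (t ^ k * t ^ e) * g * den q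
      ≈⟨ solve 5 (λ a b c d e → ((a ⊕ (b ⊕ c)) ⊕ d) ⊕ e ⊜ b ⊕ ((a ⊕ (c ⊕ d)) ⊕ e)) refl
           t (t ^ k) (t ^ e) g (den q) ⟩
    t ^ k * (t * (t ^ e * g) * den q)    ∎))

  -- Expansion of J where one numerator of Φ is divisible by a high power of t.

  module _ {n p : ℕ} (a : Carrier) (Λ x : Fin n → Carrier) (s : Carrier) (i : Fin n) where
    open Coordinates rawRing using (Φ; W; J)
    open RawSemiringDefs (RawRing.rawSemiring rawRing) using () renaming (_×_ to _·_)

    private
      φ : ℕ → Fraction
      φ j = Φ (1# ⁄ t) a Λ x (s + j · a)

      w : ℕ → Fin n → Carrier
      w d = W Λ x (s + d · a)

      ratio : ℕ → Fin n → Fraction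
      ratio j l = (s + j · a - x l + Λ l) ⁄ (s + j · a - x l + a)

    module _
      -- `p` is one less than the number of summands of J, so Φ is evaluated only at the shifts j <
      -- `p`, while the zero below has order `suc p`.
      (unit : ∀ l j → j < p → Unit (s + j · a - x l + a))
      (root-order : ∃[ g ] s + 0 · a - x i + Λ i ≈ t ^ suc p * g)
      where

      ratio-order : ∀ j l → j < p → Order 0 0 (ratio j l)
      ratio-order j l j<p = Order-⁄ 0 (sym (*-identityˡ _)) (unit l j j<p)

      Φ-order : ∀ j → j < p → Order 1 0 (φ j)
      Φ-order j j<p = ≡.subst (λ k → Order (suc k) 0 (φ j)) (ℕ.*-zeroʳ n)
        (Order-* {q = 1# ⁄ t} {r = F.product (ratio j)} Order-t⁻¹
          (Order-product {k = 0} {ratio j} λ l → ratio-order j l j<p))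

      Φ₀-order : 0 < p → Order 1 (suc p) (φ 0)
      Φ₀-order 0<p = Order-* {q = 1# ⁄ t} {r = F.product (ratio 0)} Order-t⁻¹
        (Order-product-at {m = suc p} {ratio 0} i (λ l → ratio-order 0 l 0<p)
          (Order-⁄ (suc p) (proj₂ root-order) (unit i 0 0<p)))

      -- Each of the d + 1 factors brings one pole from κ, and the factor at shift 0 alone brings
      -- the whole zero. Since d + 1 ≤ `p`, the zero exceeds the pole by at least one.
      ΠΦ-order : ∀ d → d < p → Order (suc d) (suc p) (F.product {suc d} (φ ∘ toℕ))
      ΠΦ-order d d<p =
        ≡.subst₂ (λ k m → Order (suc k) m (F.product {suc d} (φ ∘ toℕ)))
          (ℕ.*-identityʳ d) (ℕ.+-identityʳ (suc p))
          (Order-* {q = φ 0} {r = F.product {d} (φ ∘ suc ∘ toℕ)}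
            (Φ₀-order (ℕ.≤-<-trans z≤n d<p))
            (Order-product {k = 1} {φ ∘ suc ∘ toℕ} λ j →
              Φ-order (suc (toℕ j)) (ℕ.≤-<-trans (Fin.toℕ<n j) d<p)))

      module _ (k : Fin n) where

        summand : ℕ → Fraction
        summand d = fromRing (w d k) F.* F.product {d} (φ ∘ toℕ)

        summand-≗ : ∀ d → d < p → ∃[ h ] summand (suc d) ≗ t * h
        summand-≗ d d<p = scale-≗ (w (suc d) k) (F.product {suc d} (φ ∘ toℕ))
          (Order⇒≗ (s≤s d<p) (ΠΦ-order d d<p))

        -- The summand 0 carries the empty product of values of Φ and is W itself; every other
        -- summand goes into the remainder.
        J-expansion : ∃[ h ] J (suc p) (1# ⁄ t) a Λ x s k ≗ W Λ x (s + 0 · a) k + t * h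
        J-expansion = proj₁ rest , +-≗ {q = summand 0} {r = F.sum {p} (summand ∘ suc ∘ toℕ)}
          (≗-cong (*-identityʳ _)
            (*-≗ {q = fromRing (w 0 k)} {r = F.1#} (fromRing-≗ (w 0 k)) (fromRing-≗ 1#)))
          (proj₂ rest)
          where
          rest : ∃[ h ] F.sum {p} (summand ∘ suc ∘ toℕ) ≗ t * h
          rest = sum-≗ {p} {summand ∘ suc ∘ toℕ} λ d → summand-≗ (toℕ d) (Fin.toℕ<n d)

-- Triangular matrices and change of basis.

module Triangular {c ℓ} (R : CommutativeRing c ℓ) where
  open CommutativeRing R hiding (zero)
  open RingProperties ring using (//-rightDividesˡ)
  open SemiringSum semiring using (sum; sum-cong-≋; sum-replicate-zero)
  open SetoidReasoning setoid

  record IsTriangular {n} (M : Fin n → Fin n → Carrier) : Set (c ⊔ ℓ) where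
    field
      above    : ∀ i j → i Fin.< j → M i j ≈ 0#
      diagonal : ∀ i → ∃[ v ] M i i * v ≈ 1#

  open IsTriangular

  infixl 7 _∙_
  _∙_ : ∀ {n} → (Fin n → Carrier) → (Fin n → Fin n → Carrier) → Fin n → Carrier
  (r ∙ M) j = sum λ i → r i * M i j

  minor : ∀ {n} → (Fin (suc n) → Fin (suc n) → Carrier) → Fin n → Fin n → Carrier
  minor M i j = M (suc i) (suc j)

  minor-triangular : ∀ {n} {M : Fin (suc n) → Fin (suc n) → Carrier} →
                     IsTriangular M → IsTriangular (minor M)
  minor-triangular tri = record
    { above    = λ i j i<j → above tri (suc i) (suc j) (s≤s i<j)
    ; diagonal = λ i → diagonal tri (suc i)
    }

  -- Row 0 vanishes in every column after the first, so these columns give a smaller triangular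
  -- system for the other unknowns. The unknown `r zero` is therefore found last, from column 0.
  ∙-minor : ∀ {n} {M : Fin (suc n) → Fin (suc n) → Carrier} → IsTriangular M →
            ∀ r j → (r ∙ M) (suc j) ≈ ((r ∘ suc) ∙ minor M) j
  ∙-minor tri r j =
    trans (+-congʳ (trans (*-congˡ (above tri zero (suc j) (s≤s z≤n))) (zeroʳ (r zero))))
          (+-identityˡ _)

  ∙-injective : ∀ {n} {M : Fin n → Fin n → Carrier} → IsTriangular M →
                ∀ r → (∀ j → (r ∙ M) j ≈ 0#) → ∀ i → r i ≈ 0#
  ∙-injective {suc n} {M} tri r rM≈0 = λ { zero → r₀≈0 ; (suc i) → r₊≈0 i }
    where
    r₊≈0 : ∀ i → r (suc i) ≈ 0#
    r₊≈0 = ∙-injective (minor-triangular tri) (r ∘ suc)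
      λ j → trans (sym (∙-minor tri r j)) (rM≈0 (suc j))

    v = proj₁ (diagonal tri zero)

    r₀M₀₀≈0 : r zero * M zero zero ≈ 0#
    r₀M₀₀≈0 = begin
      r zero * M zero zero         ≈⟨ +-identityʳ _ ⟨
      r zero * M zero zero + 0#    ≈⟨ +-congˡ (sum-replicate-zero n) ⟨
      r zero * M zero zero + sum {n} (λ _ → 0#)
        ≈⟨ +-congˡ (sum-cong-≋ λ i → trans (*-congʳ (r₊≈0 i)) (zeroˡ _)) ⟨
      (r ∙ M) zero                 ≈⟨ rM≈0 zero ⟩
      0#                           ∎

    r₀≈0 : r zero ≈ 0#
    r₀≈0 = trans (RingLemmas.divide R (proj₂ (diagonal tri zero)) r₀M₀₀≈0) (zeroˡ v)

  ∙-surjective : ∀ {n} {M : Fin n → Fin n → Carrier} → IsTriangular M →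
                 ∀ (u : Fin n → Carrier) → ∃[ r ] ∀ j → (r ∙ M) j ≈ u j
  ∙-surjective {zero}      tri u = u , λ ()
  ∙-surjective {suc n} {M} tri u = r , λ
    { zero    → trans (+-congʳ (RingLemmas.undivide R (proj₂ (diagonal tri zero)) refl))
                      (//-rightDividesˡ rest (u zero))
    ; (suc j) → trans (∙-minor tri r j) (proj₂ lower j)
    }
    where
    lower = ∙-surjective (minor-triangular tri) (u ∘ suc)
    rest = sum λ i → proj₁ lower i * M (suc i) zero

    r : Fin (suc n) → Carrier
    r zero    = (u zero - rest) * proj₁ (diagonal tri zero)
    r (suc i) = proj₁ lower i

  module _ {m ℓm} (V : Module R m ℓm) where
    open Module V
    open CommutativeMonoidSum +ᴹ-commutativeMonoid using ()
      renaming (sum to sumᴹ; sum-cong-≋ to sumᴹ-cong; ∑-comm to sumᴹ-comm)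

    *ₗ-distribˡ-sum : ∀ {n} r (v : Fin n → Carrierᴹ) → r *ₗ sumᴹ v ≈ᴹ sumᴹ λ i → r *ₗ v i
    *ₗ-distribˡ-sum {zero}  r v = *ₗ-zeroʳ r
    *ₗ-distribˡ-sum {suc n} r v =
      ≈ᴹ-trans (*ₗ-distribˡ r _ _) (+ᴹ-congˡ (*ₗ-distribˡ-sum r (v ∘ suc)))

    *ₗ-distribʳ-sum : ∀ {n} (r : Fin n → Carrier) v → sum r *ₗ v ≈ᴹ sumᴹ λ i → r i *ₗ v
    *ₗ-distribʳ-sum {zero}  r v = *ₗ-zeroˡ v
    *ₗ-distribʳ-sum {suc n} r v =
      ≈ᴹ-trans (*ₗ-distribʳ v _ _) (+ᴹ-congˡ (*ₗ-distribʳ-sum (r ∘ suc) v))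

    linearCombination-cong : ∀ {n} {r r′ : Fin n → Carrier} (v : Fin n → Carrierᴹ) →
      (∀ i → r i ≈ r′ i) → linearCombination R V r v ≈ᴹ linearCombination R V r′ v
    linearCombination-cong v r≈r′ = sumᴹ-cong λ i → *ₗ-congʳ (r≈r′ i)

    linearCombination-∙ : ∀ {n} r (M : Fin n → Fin n → Carrier) (v : Fin n → Carrierᴹ) →
      linearCombination R V r (λ i → linearCombination R V (M i) v)
        ≈ᴹ linearCombination R V (r ∙ M) v
    linearCombination-∙ r M v =
      ≈ᴹ-trans (sumᴹ-cong λ i → ≈ᴹ-trans (*ₗ-distribˡ-sum (r i) (λ j → M i j *ₗ v j))
        (sumᴹ-cong λ j → ≈ᴹ-sym (*ₗ-assoc (r i) (M i j) (v j))))
      (≈ᴹ-trans (sumᴹ-comm λ i j → (r i * M i j) *ₗ v j)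
      (sumᴹ-cong λ j → ≈ᴹ-sym (*ₗ-distribʳ-sum (λ i → r i * M i j) (v j))))

    -- A combination with coefficients r of the new vectors has coordinates r ∙ M in the old basis,
    -- so independence and spanning become injectivity and surjectivity of r ↦ r ∙ M.
    triangular-basis : ∀ {n} {M : Fin n → Fin n → Carrier} {v : Fin n → Carrierᴹ} →
      IsTriangular M → IsBasis R V v → IsBasis R V (λ i → linearCombination R V (M i) v)
    triangular-basis {M = M} {v} tri basis = record
      { linearlyIndependent = λ r lc≈0 → ∙-injective tri r
          (linearlyIndependent (r ∙ M) (≈ᴹ-trans (≈ᴹ-sym (linearCombination-∙ r M v)) lc≈0))
      ; spanning = λ u →
          let b , u≈bv = spanning u
              r , rM≈b = ∙-surjective tri b
          in r , ≈ᴹ-trans u≈bv (≈ᴹ-trans (linearCombination-cong v (λ j → sym (rM≈b j)))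
                   (≈ᴹ-sym (linearCombination-∙ r M v)))
      }
      where open IsBasis basis

-- Finite products of series and their constant terms.

module PowerSeriesProducts {c ℓ} (R : CommutativeRing c ℓ) where
  open CommutativeRing R hiding (zero)
  open PowerSeriesRing R
  open PowerSeries rawRing using (Series; const; ε) renaming (rawRing to rawRingˢ)
  open RawSemiringDefs (RawRing.rawSemiring rawRing) using (product) renaming (_×_ to _·_)
  private
    module P where
      open RawSemiringDefs (RawRing.rawSemiring rawRingˢ) public using (product) renaming (_×_ to _·_)
      open Coordinates rawRingˢ public using (W)
  open Coordinates rawRing using (W)

  product-cong : ∀ {n} {f g : Fin n → Carrier} → (∀ i → f i ≈ g i) → product f ≈ product g
  product-cong {zero}  f≈g = refl
  product-cong {suc n} f≈g = *-cong (f≈g zero) (product-cong (f≈g ∘ suc))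

  product-constantTerm : ∀ {n} (f : Fin n → Series) →
                         P.product f 0 ≈ product λ i → f i 0
  product-constantTerm {zero}  f = refl
  product-constantTerm {suc n} f = trans (*ˢ-constantTerm (f zero) (P.product (f ∘ suc)))
    (*-congˡ (product-constantTerm (f ∘ suc)))

  product-nonexpansive : ∀ {n} {F : Fin n → Series → Series} →
    (∀ i → Nonexpansive (F i)) → Nonexpansive (λ s → P.product λ i → F i s)
  product-nonexpansive {zero}      nonexp f≡g = λ _ → refl
  product-nonexpansive {suc n} {F} nonexp {f} {g} f≡g = *ˢ-cong-≡[]
    {F zero f} {F zero g} {P.product λ i → F (suc i) f} {P.product λ i → F (suc i) g}
    (nonexp zero f≡g) (product-nonexpansive (nonexp ∘ suc) f≡g)

  -- J shifts by multiples of the series `const a`, whereas the branch equation uses constants of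
  -- multiples of `a`. The two are compared only through constant terms.
  ·-constantTerm : ∀ k f → (k P.· f) 0 ≈ k · f 0
  ·-constantTerm zero    f = refl
  ·-constantTerm (suc k) f = +-congˡ (·-constantTerm k f)

  W-constantTerm : ∀ {n} (Λ x : Fin n → Carrier) s {y} → s 0 ≈ y → ∀ k →
    P.W (λ l → const (Λ l)) (λ l → const (x l)) s k 0 ≈ W Λ x y k
  W-constantTerm {n} Λ x s {y} s₀≈y k =
    trans (*ˢ-constantTerm (P.product A) (P.product B)) (*-cong
      (trans (product-constantTerm A) (product-cong {n} {λ l → A l 0} {A₀}
        λ l → if-constantTerm (does (l Fin.<? k)) _ (+-congʳ (+-congʳ s₀≈y))))
      (trans (product-constantTerm B) (product-cong {n} {λ l → B l 0} {B₀}
        λ l → if-constantTerm (does (k Fin.<? l)) _ (+-congʳ s₀≈y))))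
    where
    A B : Fin n → Series
    A l = if does (l Fin.<? k) then s +ˢ -ˢ const (x l) +ˢ const (Λ l) else 1ˢ
    B l = if does (k Fin.<? l) then s +ˢ -ˢ const (x l) else 1ˢ

    A₀ B₀ : Fin n → Carrier
    A₀ l = if does (l Fin.<? k) then y - x l + Λ l else 1#
    B₀ l = if does (k Fin.<? l) then y - x l else 1#

    if-constantTerm : ∀ b (f : Series) {r} → f 0 ≈ r →
                      (if b then f else 1ˢ) 0 ≈ (if b then r else 1#)
    if-constantTerm true  f f₀≈r = f₀≈r
    if-constantTerm false f f₀≈r = refl

-- Units and nonvanishing over a Heyting field.

module Field {c ℓ₁ ℓ₂} (K : HeytingField c ℓ₁ ℓ₂) where
  open HeytingField K using (_#_; #-irrefl; #⇒invertible; heytingCommutativeRing)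
  open HeytingProperties heytingCommutativeRing
    using (invertibleʳ⇒#; x-0≈x; 1#0; x#0y#0→xy#0; #-congʳ)
  open OverField K
  open CommutativeRing commutativeRing hiding (zero)
  open RingProperties ring using (-‿+-comm; -‿involutive)
  open RawSemiringDefs (RawRing.rawSemiring rawRing) using (product) renaming (_×_ to _·_)
  open PowerSeriesRing commutativeRing hiding (_≈ˢ_)
  open PowerSeriesProducts commutativeRing
  open FractionOrder commutativeRingˢ ε ε-*ˢ-cancelˡ
  open Triangular commutativeRing using (IsTriangular)
  open SetoidReasoning setoid
  private
    module P where
      open RawSemiringDefs (RawRing.rawSemiring K[[ε]]) public
        using (product; _^_) renaming (_×_ to _·_)
      open CommutativeMonoidSum (CommutativeRing.*-commutativeMonoid commutativeRingˢ) public
        using (sum-remove)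

  #0⇒unit : ∀ {r} → r # 0# → ∃[ v ] r * v ≈ 1#
  #0⇒unit {r} r#0 with #⇒invertible r#0
  ... | v , _ , [r-0]v≈1 = v , trans (*-congʳ (sym (x-0≈x r))) [r-0]v≈1

  unit⇒#0 : ∀ {r v} → r * v ≈ 1# → r # 0#
  unit⇒#0 {r} {v} rv≈1 = invertibleʳ⇒# (v , trans (*-congʳ (x-0≈x r)) rv≈1)

  #⇒-#0 : ∀ {r s} → r # s → r - s # 0#
  #⇒-#0 r#s with #⇒invertible r#s
  ... | v , _ , [r-s]v≈1 = unit⇒#0 [r-s]v≈1

  product-#0 : ∀ {n} {f : Fin n → Carrier} → (∀ i → f i # 0#) → product f # 0#
  product-#0 {zero}  f#0 = 1#0
  product-#0 {suc n} f#0 = x#0y#0→xy#0 (f#0 zero) (product-#0 (f#0 ∘ suc))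

  product-zero : ∀ {n} {f : Fin n → Carrier} i → f i ≈ 0# → product f ≈ 0#
  product-zero zero    fᵢ≈0 = trans (*-congʳ fᵢ≈0) (zeroˡ _)
  product-zero (suc i) fᵢ≈0 = trans (*-congˡ (product-zero i fᵢ≈0)) (zeroʳ _)

  if-#0 : ∀ {p} {P : Set p} (P? : Dec P) {r} → (P → r # 0#) →
          (if does P? then r else 1#) # 0#
  if-#0 (yes p) r#0 = r#0 p
  if-#0 (no ¬p) r#0 = 1#0

  ε^-*ˢ-coefficient : ∀ k f → ((ε P.^ k) *ˢ f) k ≈ f 0
  ε^-*ˢ-coefficient zero    f = *ˢ-identityˡ f 0
  ε^-*ˢ-coefficient (suc k) f = begin
    ((ε *ˢ (ε P.^ k)) *ˢ f) (suc k)   ≈⟨ *ˢ-assoc ε (ε P.^ k) f (suc k) ⟩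
    (ε *ˢ ((ε P.^ k) *ˢ f)) (suc k)   ≈⟨ ε-*ˢ-suc ((ε P.^ k) *ˢ f) k ⟩
    ((ε P.^ k) *ˢ f) k                ≈⟨ ε^-*ˢ-coefficient k f ⟩
    f 0                               ∎

  seriesUnit : ∀ u → u 0 # 0# → Unit u
  seriesUnit u u₀#0 with #0⇒unit u₀#0
  ... | c , u₀c≈1 = inverse c u , inverse-inverseʳ c u (trans (*-comm c (u 0)) u₀c≈1)

  -- The coefficient at k of εᵏ u is u(0), which is inverted by the constant term of the inverse of
  -- u.
  powerTimesUnit⇒nonzero : ∀ {f} → PowerTimesUnit f → ∃[ k ] f k # 0#
  powerTimesUnit⇒nonzero {f} (k , u , (v , uv≈1) , f≈) = k ,
    #-congʳ (sym (trans (f≈ k) (ε^-*ˢ-coefficient k u)))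
      (unit⇒#0 (trans (sym (*ˢ-constantTerm u v)) (uv≈1 0)))

  ≗⇒≐ : ∀ {q g g′} → g ≈ˢ g′ → q ≗ g → q ≐ g′
  ≗⇒≐ {q} {g} {g′} g≈g′ (represents q-den q≈) = powerTimesUnit⇒nonzero q-den ,
    λ k → trans (*ˢ-comm (num q) 1ˢ k) (trans (*ˢ-identityˡ (num q) k)
      (trans (q≈ k) (*ˢ-cong {g} {g′} {den q} {den q} g≈g′ (λ _ → refl) k)))

  +O[ε]⇒Regular : ∀ {n} {q : Fin n → Fraction} {w : Fin n → Carrier} →
                  q ≐ w +O[ε] → Regular q
  +O[ε]⇒Regular {w = w} expansion k =
    const (w k) +ˢ ε *ˢ proj₁ (expansion k) , proj₂ (expansion k)

  -- Values of the linear factors at yᵢ.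

  module _ {n p : ℕ} (a : Carrier) (Λ x : Fin n → Carrier)
           (distinct : FactorsDistinct {suc p} a Λ x) where

    private
      y : Fin n → Carrier
      y i = x i - Λ i

      coeff₁≈1 : ∀ v → LinearPoly.coeff₁ (factor {suc p} a Λ x v) ≈ 1#
      coeff₁≈1 (inj₁ _) = refl
      coeff₁≈1 (inj₂ _) = refl

      coeff₀ : (Fin n × Fin (suc p)) ⊎ (Fin n × Fin (suc p)) → Carrier
      coeff₀ u = LinearPoly.coeff₀ (factor a Λ x u)

    y-root : ∀ i → y i - x i + Λ i ≈ 0#
    y-root i = trans (sym (RingLemmas.x-[y-z]≈x-y+z commutativeRing (y i) (x i) (Λ i))) (-‿inverseʳ (y i))

    -- Distinctness enters the proof here. Since yᵢ is the root of the factor (i, 0), the value of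
    -- another factor at yᵢ is the difference of the two constant coefficients. Both polynomials are
    -- monic, so it is these coefficients that are apart.
    value-#0 : ∀ i v → inj₁ (i , zero) ≢ v → y i + coeff₀ v # 0#
    value-#0 i v v≢ with distinct v (inj₁ (i , zero)) (v≢ ∘ ≡.sym)
    ... | inj₁ cv#cu = contradiction cv#cu (#-irrefl (coeff₁≈1 v))
    ... | inj₂ cv#cu = #-congʳ (trans (+-comm _ _) (+-congʳ -coeff₀≈y)) (#⇒-#0 cv#cu)
      where
      -coeff₀≈y : - (- x i + Λ i + 0#) ≈ y i
      -coeff₀≈y = begin
        - (- x i + Λ i + 0#)   ≈⟨ -‿cong (+-identityʳ _) ⟩
        - (- x i + Λ i)        ≈⟨ -‿+-comm (- x i) (Λ i) ⟨
        - - x i - Λ i          ≈⟨ +-congʳ (-‿involutive (x i)) ⟩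
        x i - Λ i              ∎

    upper-#0 : ∀ i l j → (l , j) ≢ (i , zero) → y i - x l + Λ l + toℕ j · a # 0#
    upper-#0 i l j lj≢i0 = #-congʳ
      (sym (trans (+-congʳ (+-assoc _ _ _)) (+-assoc _ _ _)))
      (value-#0 i (inj₁ (l , j)) λ { ≡.refl → lj≢i0 ≡.refl })

    lower-#0 : ∀ i l j → y i - x l + toℕ j · a # 0#
    lower-#0 i l j = #-congʳ (sym (+-assoc _ _ _)) (value-#0 i (inj₂ (l , j)) λ ())

    W-triangular : IsTriangular λ i → W Λ x (y i)
    W-triangular = record
      { above    = λ i j i<j → trans (*-congʳ (product-zero i (factor-zero i j i<j))) (zeroˡ _)
      -- W_i takes upper factors only for l < i and lower factors only for l > i, so the vanishing
      -- factor (i, 0) does not occur in it.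
      ; diagonal = λ i → #0⇒unit (x#0y#0→xy#0
          (product-#0 λ l → if-#0 (l Fin.<? i) λ l<i → #-congʳ (+-identityʳ _)
            (upper-#0 i l zero λ { ≡.refl → Fin.<-irrefl ≡.refl l<i }))
          (product-#0 λ l → if-#0 (i Fin.<? l) λ _ → #-congʳ (+-identityʳ _) (lower-#0 i l zero)))
      }
      where
      factor-zero : ∀ i j → i Fin.< j → (if does (i Fin.<? j) then y i - x i + Λ i else 1#) ≈ 0#
      factor-zero i j i<j rewrite dec-true (i Fin.<? j) i<j = y-root i

  -- The branch through yᵢ, and J along it.

  module Branch {n p : ℕ} (a : Carrier) (Λ x : Fin (suc n) → Carrier)
                (distinct : FactorsDistinct {suc p} a Λ x) (i : Fin (suc n)) where

    private
      y : Carrier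
      y = x i - Λ i

      upper lower : Series → Fin (suc n) → Fin (suc p) → Series
      upper s l j = s +ˢ -ˢ const (x l) +ˢ const (Λ l) +ˢ const (toℕ j · a)
      lower s l j = s +ˢ -ˢ const (x l) +ˢ const (toℕ j · a)

      upperRow : Series → Fin (suc n) → Series
      upperRow s l = P.product (upper s l)

      lowerProduct : Series → Series
      lowerProduct s = P.product λ l → P.product (lower s l)

      -- `ownRow` omits the shift 0 because `upper s i zero` amounts to s - y, the only upper factor
      -- vanishing at y. `Q` contains ε to the power `p`, one less than the branch equation: the
      -- remaining ε is the one that `Hensel` uses to contract.
      ownRow otherRows U Q : Series → Series
      ownRow s    = P.product λ j → upper s i (suc j)
      otherRows s = P.product (removeAt (upperRow s) i)
      U s = ownRow s *ˢ otherRows s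
      Q s = (ε P.^ p) *ˢ lowerProduct s

      upper-nonexpansive : ∀ l j → Nonexpansive λ s → upper s l j
      upper-nonexpansive l j f≡g k<m = +-congʳ (+-congʳ (+-congʳ (f≡g k<m)))

      U-nonexpansive : Nonexpansive U
      U-nonexpansive {f} {g} f≡g = *ˢ-cong-≡[] {ownRow f} {ownRow g} {otherRows f} {otherRows g}
        (product-nonexpansive {F = λ j s → upper s i (suc j)}
          (λ j {f} {g} → upper-nonexpansive i (suc j) {f} {g}) f≡g)
        (product-nonexpansive {F = λ l s → upperRow s (punchIn i l)} (λ l {f} {g} →
          product-nonexpansive {F = λ j s → upper s (punchIn i l) j}
            (λ j {f} {g} → upper-nonexpansive (punchIn i l) j {f} {g}) {f} {g}) f≡g)

      Q-nonexpansive : Nonexpansive Q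
      Q-nonexpansive {f} {g} f≡g =
        *ˢ-cong-≡[] {ε P.^ p} {ε P.^ p} {lowerProduct f} {lowerProduct g} (λ _ → refl)
          (product-nonexpansive {F = λ l s → P.product (lower s l)} (λ l {f} {g} →
            product-nonexpansive {F = λ j s → lower s l j}
              (λ j {f} {g} f≡g k<m → +-congʳ (+-congʳ (f≡g k<m))) {f} {g}) f≡g)

      productˢ-#0 : ∀ {m} (f : Fin m → Series) → (∀ j → f j 0 # 0#) → P.product f 0 # 0#
      productˢ-#0 f f₀#0 = #-congʳ (sym (product-constantTerm f)) (product-#0 f₀#0)

      U-#0 : U (const y) 0 # 0#
      U-#0 = #-congʳ (sym (*ˢ-constantTerm (ownRow (const y)) (otherRows (const y)))) (x#0y#0→xy#0
        (productˢ-#0 (λ j → upper (const y) i (suc j)) λ j →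
          upper-#0 a Λ x distinct i i (suc j) λ ())
        (productˢ-#0 (removeAt (upperRow (const y)) i) λ l →
          productˢ-#0 (upper (const y) (punchIn i l)) λ j →
            upper-#0 a Λ x distinct i (punchIn i l) j λ eq → Fin.punchInᵢ≢i i l (≡.cong proj₁ eq)))

      U₀⁻¹ : Carrier
      U₀⁻¹ = proj₁ (#0⇒unit U-#0)

      U-inverse : ∀ {s} → s 0 ≈ y → U₀⁻¹ * U s 0 ≈ 1#
      U-inverse {s} s₀≈y = begin
        U₀⁻¹ * U s 0            ≈⟨ *-comm _ _ ⟩
        -- Nonexpansiveness modulo ε says that the constant term of `U s` depends only on that of
        -- `s`.
        U s 0 * U₀⁻¹            ≈⟨ *-congʳ (U-nonexpansive {s} {const y} {1} s≡y (s≤s z≤n)) ⟩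
        U (const y) 0 * U₀⁻¹    ≈⟨ proj₂ (#0⇒unit U-#0) ⟩
        1#                      ∎
        where
        s≡y : s ≡[ 1 ] const y
        s≡y (s≤s z≤n) = s₀≈y

      module H = Hensel y U₀⁻¹ U Q
        (λ {f} {g} {k} → U-nonexpansive {f} {g} {k}) (λ {f} {g} {k} → Q-nonexpansive {f} {g} {k})
        (λ {s} → U-inverse {s})

      upper-root : ∀ s → s +ˢ -ˢ const (x i) +ˢ const (Λ i) +ˢ 0ˢ ≈ˢ s +ˢ -ˢ const y
      upper-root s zero    = trans (+-identityʳ _) (sym (RingLemmas.x-[y-z]≈x-y+z commutativeRing _ _ _))
      upper-root s (suc k) = trans (+-identityʳ _) (+-identityʳ _)

      upperProduct-factors : ∀ s → P.product (upperRow s) ≈ˢ (s +ˢ -ˢ const y) *ˢ U s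
      upperProduct-factors s k = begin
        -- Here `sum-remove` is taken in the multiplicative monoid, so it pulls row i out of the
        -- product; the head of that row is the vanishing factor.
        P.product (upperRow s) k                        ≈⟨ P.sum-remove {n} {i} (upperRow s) k ⟩
        ((upper s i zero *ˢ ownRow s) *ˢ otherRows s) k
          ≈⟨ *ˢ-assoc (upper s i zero) (ownRow s) (otherRows s) k ⟩
        (upper s i zero *ˢ U s) k
          ≈⟨ *ˢ-cong {upper s i zero} {s +ˢ -ˢ const y} {U s} {U s} (upper-root s) (λ _ → refl) k ⟩
        ((s +ˢ -ˢ const y) *ˢ U s) k                    ∎

      lower-factors : ∀ s → (ε P.^ suc p) *ˢ lowerProduct s ≈ˢ ε *ˢ Q s
      lower-factors s = *ˢ-assoc ε (ε P.^ p) (lowerProduct s)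

      root⇒branch : ∀ {s} → H.IsRoot s → IsBranch (suc p) a Λ x y s
      root⇒branch {s} (s₀≈y , equation) = record
        { initial  = s₀≈y
        ; equation = λ k → trans (upperProduct-factors s k)
            (trans (equation k) (sym (lower-factors s k)))
        }

      branch⇒root : ∀ {s} → IsBranch (suc p) a Λ x y s → H.IsRoot s
      branch⇒root {s} branch = IsBranch.initial branch , λ k →
        trans (sym (upperProduct-factors s k))
          (trans (IsBranch.equation branch k) (lower-factors s k))

    branch-unique-exists : ∃! _≈ˢ_ (IsBranch (suc p) a Λ x y)
    branch-unique-exists = H.root , root⇒branch {H.root} H.root-isRoot , λ {s} branch →
      H.root-unique {H.root} {s} H.root-isRoot (branch⇒root {s} branch)

    pullbackJ-expansion : ∀ s → IsBranch (suc p) a Λ x y s →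
                          pullbackJ (suc p) a Λ x s ≐ W Λ x y +O[ε]
    -- W(s) agrees with W(y) only in its constant term; the rest of it, `tail Wₛ`, joins the
    -- remainder of J.
    pullbackJ-expansion s branch k = tail Wₛ +ˢ h , ≗⇒≐ Wₛ+εh≈ (proj₂ expansion)
      where
      s₀≈y = IsBranch.initial branch
      -- The shift of the summand 0 is zero times a, which computes to the zero series but is still
      -- added to `s`.
      s′ = s +ˢ 0ˢ

      Wₛ : Series
      Wₛ = Coordinates.W K[[ε]] (λ l → const (Λ l)) (λ l → const (x l)) s′ k

      -- The denominator of Φ at shift j has the same constant term as the lower factor at shift j +
      -- 1. As j < `p`, that shift still lies among the `suc p` available ones, without wrapping
      -- around modulo the characteristic.
      denominators : ∀ l j → j < p →
                     Unit (s +ˢ (j P.· const a) +ˢ -ˢ const (x l) +ˢ const a)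
      denominators l j j<p = seriesUnit
        (s +ˢ (j P.· const a) +ˢ -ˢ const (x l) +ˢ const a)
        (#-congʳ (sym constantTerm≈) (lower-#0 a Λ x distinct i l (suc (Fin.fromℕ< j<p))))
        where
        constantTerm≈ : s 0 + (j P.· const a) 0 - x l + a
                      ≈ y - x l + suc (toℕ (Fin.fromℕ< j<p)) · a
        constantTerm≈ = begin
          s 0 + (j P.· const a) 0 - x l + a     ≈⟨ +-congʳ (+-congʳ (+-cong s₀≈y (·-constantTerm j (const a)))) ⟩
          y + j · a - x l + a                   ≈⟨ +-congʳ (+-assoc _ _ _) ⟩
          y + (j · a - x l) + a                 ≈⟨ +-congʳ (+-congˡ (+-comm _ _)) ⟩
          y + (- x l + j · a) + a               ≈⟨ +-congʳ (+-assoc _ _ _) ⟨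
          y - x l + j · a + a                   ≈⟨ +-assoc _ _ _ ⟩
          y - x l + (j · a + a)                 ≈⟨ +-congˡ (+-comm _ _) ⟩
          y - x l + suc j · a                   ≡⟨ ≡.cong (λ j → y - x l + suc j · a) (Fin.toℕ-fromℕ< j<p) ⟨
          y - x l + suc (toℕ (Fin.fromℕ< j<p)) · a ∎

      root-order : ∃[ g ] s +ˢ 0ˢ +ˢ -ˢ const (x i) +ˢ const (Λ i) ≈ˢ (ε P.^ suc p) *ˢ g
      -- Dividing the branch equation by `U s` turns s - y into ε to the power `suc p` times this
      -- quotient.
      root-order = lowerProduct s *ˢ inverse U₀⁻¹ (U s) , λ k → begin
        (s +ˢ 0ˢ +ˢ -ˢ const (x i) +ˢ const (Λ i)) k
          ≈⟨ +-congʳ (+-congʳ (trans (+-congˡ (0ˢ≈0 k)) (+-identityʳ _))) ⟩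
        (s +ˢ -ˢ const (x i) +ˢ const (Λ i)) k
          ≈⟨ trans (+-congˡ (0ˢ≈0 k)) (+-identityʳ _) ⟨
        (s +ˢ -ˢ const (x i) +ˢ const (Λ i) +ˢ 0ˢ) k
          ≈⟨ upper-root s k ⟩
        (s +ˢ -ˢ const y) k
          ≈⟨ H.root-factor {s} (branch⇒root branch) k ⟩
        ((ε *ˢ Q s) *ˢ inverse U₀⁻¹ (U s)) k
          ≈⟨ *ˢ-cong {ε *ˢ Q s} {(ε P.^ suc p) *ˢ lowerProduct s}
               {inverse U₀⁻¹ (U s)} {inverse U₀⁻¹ (U s)}
               (λ k → sym (lower-factors s k)) (λ _ → refl) k ⟩
        (((ε P.^ suc p) *ˢ lowerProduct s) *ˢ inverse U₀⁻¹ (U s)) k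
          ≈⟨ *ˢ-assoc (ε P.^ suc p) (lowerProduct s) (inverse U₀⁻¹ (U s)) k ⟩
        ((ε P.^ suc p) *ˢ (lowerProduct s *ˢ inverse U₀⁻¹ (U s))) k ∎

      expansion : ∃[ h ] pullbackJ (suc p) a Λ x s k ≗ Wₛ +ˢ ε *ˢ h
      expansion = J-expansion (const a) (λ l → const (Λ l)) (λ l → const (x l)) s i
        denominators root-order k

      h = proj₁ expansion

      Wₛ+εh≈ : Wₛ +ˢ ε *ˢ h ≈ˢ const (W Λ x y k) +ˢ ε *ˢ (tail Wₛ +ˢ h)
      Wₛ+εh≈ j = begin
        Wₛ j + (ε *ˢ h) j
          ≈⟨ +-congʳ (constantTerm+tail Wₛ j) ⟩
        const (Wₛ 0) j + (ε *ˢ tail Wₛ) j + (ε *ˢ h) j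
          ≈⟨ +-congʳ (+-congʳ (const-cong (W-constantTerm Λ x s′ (trans (+-identityʳ _) s₀≈y) k) j)) ⟩
        const (W Λ x y k) j + (ε *ˢ tail Wₛ) j + (ε *ˢ h) j
          ≈⟨ +-assoc _ _ _ ⟩
        const (W Λ x y k) j + ((ε *ˢ tail Wₛ) j + (ε *ˢ h) j)
          ≈⟨ +-congˡ (CommutativeRing.distribˡ commutativeRingˢ ε (tail Wₛ) h j) ⟨
        const (W Λ x y k) j + (ε *ˢ (tail Wₛ +ˢ h)) j ∎
        where
        const-cong : ∀ {r r′} → r ≈ r′ → const r ≈ˢ const r′
        const-cong r≈r′ zero    = r≈r′
        const-cong r≈r′ (suc j) = refl

corollaryB4 :
    ∀ {c ℓ₁ ℓ₂ m ℓm} (K : HeytingField c ℓ₁ ℓ₂) →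
    let open HeytingField K using (Carrier)
        open HeytingField K using (_-_)
        open OverField K
    in
    (p : ℕ) → HasCharacteristic p → 2 < p →
    (n : ℕ) → 1 ≤ n →
    (V : Module commutativeRing m ℓm) →
    let open Module V using (Carrierᴹ) in
    (f : Fin n → Carrierᴹ) → IsBasis commutativeRing V f →
    (Λ : Fin n → Carrier) → (∀ i → Λ i ∈𝔽ₚˣ) →
    (a : Carrier) → ¬ (a ∈𝔽ₚ) →
    (x⁰ : Fin n → Carrier) → FactorsDistinct {p} a Λ x⁰ →
    let y⁰ : Fin n → Carrier
        y⁰ i = x⁰ i - Λ i
    in
    (∀ i →
      ∃! _≈ˢ_ (IsBranch p a Λ x⁰ (y⁰ i)) ×
      (∀ s → IsBranch p a Λ x⁰ (y⁰ i) s →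
        Regular (pullbackJ p a Λ x⁰ s) ×
        (pullbackJ p a Λ x⁰ s ≐ W Λ x⁰ (y⁰ i) +O[ε])))
    ×
    IsBasis commutativeRing V
      (λ i → linearCombination commutativeRing V (W Λ x⁰ (y⁰ i)) f)
-- The bounds on p and n exclude zero; from here on `suc p` is the characteristic and `suc n` the
-- dimension.
corollaryB4 K (suc p) _ _ (suc n) _ V f f-basis Λ _ a _ x⁰ distinct =
  (λ i → Branch.branch-unique-exists a Λ x⁰ distinct i ,
    λ s branch → let expansion = Branch.pullbackJ-expansion a Λ x⁰ distinct i s branch in
      +O[ε]⇒Regular {q = pullbackJ (suc p) a Λ x⁰ s} {W Λ x⁰ (y⁰ i)} expansion , expansion) ,
  Triangular.triangular-basis commutativeRing V {M = λ i → W Λ x⁰ (y⁰ i)}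
    (W-triangular a Λ x⁰ distinct) f-basis
  where
  open HeytingField K using (Carrier; _-_)
  open OverField K
  open Field K

  y⁰ : Fin (suc n) → Carrier
  y⁰ i = x⁰ i - Λ i
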